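{- Let $n\geq 1$ and $m\geq 2$, and let $H_1$ and $H_2$ be the components of $R_t(T(2n+1,2m))$ containing $M_1=E_1\cup E_3\cup\cdots\cup E_{2m-1}$ and $M_2=E_2\cup E_4\cup\cdots\cup E_{2m}$ respectively. Then $H_1$ and $H_2$ are isomorphic.
   Context: $T(2n+1,2m)$ is the graph with vertices $(u_i,v_j)$, $i\in\mathbb{Z}_{2m}$, $j\in\mathbb{Z}_{2n+1}$, where $(u_i,v_j)$ is adjacent to $(u_{i+1},v_j)$ and $(u_i,v_{j+1})$, cellularly embedded in the torus with faces the $4$-cycles $(u_i,v_j)(u_{i+1},v_j)(u_{i+1},v_{j+1})(u_i,v_{j+1})$. For $1\le i\le 2m$, $E_i=\{(u_i,v_j)(u_{i+1},v_j):1\le j\le 2n+1\}$ (index mod $2m$). The total resonance graph $R_t(G)$ has the perfect matchings as vertices, two perfect matchings $M,M'$ being adjacent iff $M\oplus M'$ is exactly the boundary of one face. (These are distinct components, and they are the only two components.) -}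

module Defs where

open import Data.Bool.Base using (Bool; true; false; _xor_)
open import Data.Bool.Properties using (xor-comm; xor-same)
open import Data.Fin.Base using (Fin; toℕ)
open import Data.Fin.Properties as Fin
  using (any?; toℕ-fromℕ<; toℕ-injective; toℕ<n)
open import Data.Nat.Base
  using (ℕ; zero; suc; _+_; _*_; _<_; parity)
open import Data.Nat.DivMod
  using (_mod_; _%_; m%n<n; m<n⇒m%n≡m; n%n≡0; [m+n]%n≡m%n)
open import Data.Nat.Properties as ℕ using (m≤n⇒m<n∨m≡n; n<1+n; +-suc)
open import Data.Parity.Base using (Parity; 0ℙ; 1ℙ; _⁻¹)
open import Data.Parity.Properties as ℙ
  using (p≢p⁻¹; ⁻¹-involutive; suc-homo-⁻¹; *-homo-*)
open import Data.Product
  using (Σ; ∃-syntax; ∃!; _×_; _,_; proj₁; proj₂)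
open import Data.Product.Properties using (≡-dec)
open import Data.Sum.Base using (_⊎_; inj₁; inj₂)
open import Function.Base using (_on_)
open import Function.Bundles using (Inverse; _⇔_; mk⇔; Equivalence)
open import Level using (0ℓ)
open import Relation.Binary.Bundles using (Setoid)
open import Relation.Binary.Construct.Closure.ReflexiveTransitive using (Star)
import Relation.Binary.Construct.On as On
open import Relation.Binary.Core using (Rel; _⇒_)
open import Relation.Binary.Definitions
  using (Symmetric; Irreflexive; _Respects₂_; Decidable; DecidableEquality)
open import Relation.Binary.PropositionalEquality
  using (_≡_; refl; sym; trans; cong; subst)
open import Relation.Nullary.Decidable
  using (Dec; yes; does; does-⇔; _×-dec_; _⊎-dec_; dec-true)
open import Relation.Nullary.Negation using (contradiction)

-- The vertices form a setoid because a vertex of a resonance graph is a set of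
-- edges, and two sets of edges are identified when they have the same elements.
record Graph : Set₁ where
  infix 4 _~_
  field
    vertices : Setoid 0ℓ 0ℓ
  open Setoid vertices public using (_≈_) renaming (Carrier to Vertex)
  field
    _~_    : Rel Vertex 0ℓ
    resp   : _~_ Respects₂ _≈_
    symm   : Symmetric _~_
    irrefl : Irreflexive _≈_ _~_

module _ (G : Graph) where
  open Graph G

  -- There is a walk from u to v; its last vertex need only be ≈ v.
  Reachable : Rel Vertex 0ℓ
  Reachable u v = ∃[ w ] Star _~_ u w × w ≈ v

  component : Vertex → Graph
  component u = record
    { vertices = On.setoid {B = Σ Vertex (Reachable u)} vertices proj₁
    ; _~_      = _~_ on proj₁
    ; resp     = (λ {x} → proj₁ resp {proj₁ x}) , (λ {x} → proj₂ resp {proj₁ x})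
    ; symm     = symm
    ; irrefl   = irrefl
    }

infix 4 _≅_
record _≅_ (G H : Graph) : Set where
  private
    module G = Graph G
    module H = Graph H
  field
    bijection : Inverse G.vertices H.vertices
  open Inverse bijection public
  field
    adjacent : ∀ {x y} → (x G.~ y) ⇔ (to x H.~ to y)

-- Of the embedding, only the edge sets ∂ f of the face boundaries are recorded:
-- the total resonance graph depends on nothing else. A set of edges is
-- represented throughout as a symmetric relation contained in adjacency.
record EmbeddedGraph : Set₁ where
  infix 4 _~_
  field
    Vertex     : Set
    _~_        : Rel Vertex 0ℓ
    symm       : Symmetric _~_
    Face       : Set
    ∂          : Face → Rel Vertex 0ℓ
    ∂-symm     : ∀ f → Symmetric (∂ f)
    ∂⊆~        : ∀ f → ∂ f ⇒ _~_
    ∂-nonempty : ∀ f → ∃[ x ] ∃[ y ] ∂ f x y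

module _ (G : EmbeddedGraph) where
  open EmbeddedGraph G

  record PerfectMatching : Set where
    field
      edge    : Vertex → Vertex → Bool
      symm    : ∀ x y → edge x y ≡ edge y x
      ⊆~      : ∀ x y → edge x y ≡ true → x ~ y
      perfect : ∀ x → ∃! _≡_ (λ y → edge x y ≡ true)

  open PerfectMatching using (edge)

  infixl 6 _⊕_
  _⊕_ : PerfectMatching → PerfectMatching → Vertex → Vertex → Bool
  (M ⊕ M′) x y = edge M x y xor edge M′ x y

  Rₜ : Graph
  Rₜ = record
    { vertices = record
      { Carrier       = PerfectMatching
      ; _≈_           = λ M M′ → ∀ x y → edge M x y ≡ edge M′ x y
      ; isEquivalence = record
        { refl  = λ x y → refl
        ; sym   = λ p x y → sym (p x y)
        ; trans = λ p q x y → trans (p x y) (q x y)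
        }
      }
    ; _~_    = λ M M′ → ∃[ f ] ∀ x y → (M ⊕ M′) x y ≡ true ⇔ ∂ f x y
    ; resp   = (λ {M} p (f , h) → f , λ x y →
                  subst (λ b → edge M x y xor b ≡ true ⇔ ∂ f x y) (p x y) (h x y))
             , (λ {M} p (f , h) → f , λ x y →
                  subst (λ b → b xor edge M x y ≡ true ⇔ ∂ f x y) (p x y) (h x y))
    ; symm   = λ {M} {M′} (f , h) → f , λ x y →
                  subst (λ b → b ≡ true ⇔ ∂ f x y)
                        (xor-comm (edge M x y) (edge M′ x y)) (h x y)
    ; irrefl = λ {M} {M′} → irr {M} {M′}
    }
    where
    irr : Irreflexive (λ M M′ → ∀ x y → edge M x y ≡ edge M′ x y)
                      (λ M M′ → ∃[ f ] ∀ x y → (M ⊕ M′) x y ≡ true ⇔ ∂ f x y)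
    irr {M} {M′} p (f , h) with ∂-nonempty f
    ... | x , y , e
      with () ← trans (sym (Equivalence.from (h x y) e))
                  (trans (cong (_xor edge M′ x y) (p x y)) (xor-same (edge M′ x y)))

-- Fin k plays the role of ℤ/k; next and prev are i + 1 and i - 1.
next : ∀ {k} → Fin k → Fin k
next {suc k} i = suc (toℕ i) mod suc k

prev : ∀ {k} → Fin k → Fin k
prev {suc k} i = (toℕ i + k) mod suc k

private
  toℕ-next : ∀ {k} (i : Fin (suc k)) → toℕ (next i) ≡ suc (toℕ i) % suc k
  toℕ-next {k} i = toℕ-fromℕ< (m%n<n (suc (toℕ i)) (suc k))

  toℕ-prev : ∀ {k} (i : Fin (suc k)) → toℕ (prev i) ≡ (toℕ i + k) % suc k
  toℕ-prev {k} i = toℕ-fromℕ< (m%n<n (toℕ i + k) (suc k))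

  next-cases : ∀ {k} (i : Fin (suc k)) →
    toℕ (next i) ≡ suc (toℕ i) ⊎ (toℕ i ≡ k × toℕ (next i) ≡ 0)
  next-cases {k} i with m≤n⇒m<n∨m≡n (toℕ<n i)
  ... | inj₁ lt = inj₁ (trans (toℕ-next i) (m<n⇒m%n≡m lt))
  ... | inj₂ eq = inj₂ (ℕ.suc-injective eq ,
    trans (toℕ-next i) (trans (cong (_% suc k) eq) (n%n≡0 (suc k))))

  suc+k%suc-k : ∀ t k → t < suc k → (suc t + k) % suc k ≡ t
  suc+k%suc-k t k lt = trans (cong (_% suc k) (sym (+-suc t k)))
    (trans ([m+n]%n≡m%n t (suc k)) (m<n⇒m%n≡m lt))

prev-next : ∀ {k} (i : Fin k) → prev (next i) ≡ i
prev-next {suc k} i = toℕ-injective (trans (toℕ-prev (next i)) (helper (next-cases i)))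
  where
  helper : _ → (toℕ (next i) + k) % suc k ≡ toℕ i
  helper (inj₁ eq) =
    trans (cong (λ t → (t + k) % suc k) eq) (suc+k%suc-k (toℕ i) k (toℕ<n i))
  helper (inj₂ (last , eq)) =
    trans (cong (λ t → (t + k) % suc k) eq)
      (trans (m<n⇒m%n≡m (n<1+n k)) (sym last))

next-prev : ∀ {k} (i : Fin k) → next (prev i) ≡ i
next-prev {suc k} i = toℕ-injective (trans (toℕ-next (prev i))
  (trans (cong (λ t → suc t % suc k) (toℕ-prev i)) (helper (toℕ i) (toℕ<n i))))
  where
  helper : ∀ t → t < suc k → suc ((t + k) % suc k) % suc k ≡ t
  helper zero _ =
    trans (cong (λ t → suc t % suc k) (m<n⇒m%n≡m (n<1+n k))) (n%n≡0 (suc k))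
  helper (suc t) lt =
    trans (cong (λ t → suc t % suc k) (suc+k%suc-k t k (ℕ.<-trans (n<1+n t) lt)))
      (m<n⇒m%n≡m lt)

next-injective : ∀ {k} {i j : Fin k} → next i ≡ next j → i ≡ j
next-injective {i = i} {j} eq =
  trans (sym (prev-next i)) (trans (cong prev eq) (prev-next j))

parity-next : ∀ {k} → parity k ≡ 0ℙ → (i : Fin k) →
              parity (toℕ (next i)) ≡ parity (toℕ i) ⁻¹
parity-next {suc k} even i with next-cases i
... | inj₁ eq = trans (cong parity eq)
  (trans (sym (⁻¹-involutive _)) (cong _⁻¹ (suc-homo-⁻¹ (toℕ i))))
... | inj₂ (last , eq) = trans (cong parity eq) (sym
  (trans (cong (λ t → parity t ⁻¹) last)
    (trans (cong _⁻¹ (sym (suc-homo-⁻¹ k))) (trans (⁻¹-involutive _) even))))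

module _ {V : Set} where

  -- {x , y} = {p , q} as unordered pairs.
  Joins : V → V → Rel V 0ℓ
  Joins p q x y = (x ≡ p × y ≡ q) ⊎ (x ≡ q × y ≡ p)

  Joins-symm : ∀ {p q} → Symmetric (Joins p q)
  Joins-symm (inj₁ (a , b)) = inj₂ (b , a)
  Joins-symm (inj₂ (a , b)) = inj₁ (b , a)

  Joins-swap : ∀ {p q} → Joins p q ⇒ Joins q p
  Joins-swap (inj₁ e) = inj₂ e
  Joins-swap (inj₂ e) = inj₁ e

-- The pair (i , j) stands for (uᵢ , vⱼ), with i ∈ ℤ/b and j ∈ ℤ/a, and the face
-- (i , j) for the 4-cycle whose corner of least indices is (uᵢ , vⱼ).
-- The graph has no loops or parallel edges as soon as a , b ≥ 3.
T : (a b : ℕ) → EmbeddedGraph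
T a b = record
  { Vertex     = V
  ; _~_        = Adj
  ; symm       = λ where
      (i , j , inj₁ e) → i , j , inj₁ (Joins-symm e)
      (i , j , inj₂ e) → i , j , inj₂ (Joins-symm e)
  ; Face       = Fin b × Fin a
  ; ∂          = Boundary
  ; ∂-symm     = λ where
      _ (inj₁ e)               → inj₁ (Joins-symm e)
      _ (inj₂ (inj₁ e))        → inj₂ (inj₁ (Joins-symm e))
      _ (inj₂ (inj₂ (inj₁ e))) → inj₂ (inj₂ (inj₁ (Joins-symm e)))
      _ (inj₂ (inj₂ (inj₂ e))) → inj₂ (inj₂ (inj₂ (Joins-symm e)))
  ; ∂⊆~        = λ where
      (i , j) (inj₁ e)               → i , j , inj₁ e
      (i , j) (inj₂ (inj₁ e))        → next i , j , inj₂ e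
      (i , j) (inj₂ (inj₂ (inj₁ e))) → i , next j , inj₁ (Joins-swap e)
      (i , j) (inj₂ (inj₂ (inj₂ e))) → i , j , inj₂ (Joins-swap e)
  ; ∂-nonempty = λ where (i , j) → (i , j) , (next i , j) , inj₁ (inj₁ (refl , refl))
  }
  where
  V : Set
  V = Fin b × Fin a

  Adj : Rel V 0ℓ
  Adj x y = ∃[ i ] ∃[ j ]
    (Joins (i , j) (next i , j) x y ⊎ Joins (i , j) (i , next j) x y)

  Boundary : Fin b × Fin a → Rel V 0ℓ
  Boundary (i , j) x y =
      Joins (i , j)           (next i , j)      x y
    ⊎ Joins (next i , j)      (next i , next j) x y
    ⊎ Joins (next i , next j) (i , next j)      x y
    ⊎ Joins (i , next j)      (i , j)           x y

module _ {a b : ℕ} where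
  open EmbeddedGraph (T a b) using (Vertex)

  E : Fin b → Rel Vertex 0ℓ
  E i x y = ∃[ j ] Joins (i , j) (next i , j) x y

  ⋃E : Parity → Rel Vertex 0ℓ
  ⋃E p x y = ∃[ i ] parity (toℕ i) ≡ p × E i x y

  ⋃E? : ∀ p → Decidable (⋃E p)
  ⋃E? p x y = any? λ i → (parity (toℕ i) ℙ.≟ p) ×-dec any? λ j →
      ((x ≟ (i , j)) ×-dec (y ≟ (next i , j)))
    ⊎-dec ((x ≟ (next i , j)) ×-dec (y ≟ (i , j)))
    where
    _≟_ : DecidableEquality Vertex
    _≟_ = ≡-dec Fin._≟_ Fin._≟_

private
  sound : ∀ {A : Set} (A? : Dec A) → does A? ≡ true → A
  sound (yes a) _ = a

  ⋃E-symm : ∀ {a b} p → Symmetric (⋃E {a} {b} p)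
  ⋃E-symm p (i , q , j , e) = i , q , j , Joins-symm e

  parity-opposite : ∀ p q → p ≡ q ⊎ p ≡ q ⁻¹
  parity-opposite 0ℙ 0ℙ = inj₁ refl
  parity-opposite 0ℙ 1ℙ = inj₂ refl
  parity-opposite 1ℙ 0ℙ = inj₂ refl
  parity-opposite 1ℙ 1ℙ = inj₁ refl

-- The union of the Eᵢ with i of parity p, for b even.
alternating : (a b : ℕ) → parity b ≡ 0ℙ → Parity → PerfectMatching (T a b)
alternating a b even p = record
  { edge    = λ x y → does (⋃E? p x y)
  ; symm    = λ x y → does-⇔ (mk⇔ (⋃E-symm p) (⋃E-symm p)) (⋃E? p x y) (⋃E? p y x)
  ; ⊆~      = λ x y h → let i , _ , j , e = sound (⋃E? p x y) h in i , j , inj₁ e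
  ; perfect = perfect
  }
  where
  clash : ∀ i → parity (toℕ i) ≡ p → parity (toℕ (next {b} i)) ≡ p → ∀ {A : Set} → A
  clash i h h′ =
    contradiction (trans h (trans (sym h′) (parity-next even i))) (p≢p⁻¹ _)

  perfect : ∀ x → ∃! _≡_ (λ y → does (⋃E? p x y) ≡ true)
  perfect (i , j) with parity-opposite (parity (toℕ i)) p
  ... | inj₁ h = (next i , j)
    , dec-true (⋃E? p _ _) (i , h , j , inj₁ (refl , refl))
    , λ {y} m → unique (sound (⋃E? p _ y) m)
    where
    unique : ∀ {y} → ⋃E p (i , j) y → (next i , j) ≡ y
    unique (k , _  , _ , inj₁ (refl , refl)) = refl
    unique (k , h′ , _ , inj₂ (refl , refl)) = clash k h′ h
  ... | inj₂ h = (prev i , j)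
    , dec-true (⋃E? p _ _)
        (prev i , prev-parity , j , inj₂ (cong (_, j) (sym (next-prev i)) , refl))
    , λ {y} m → unique (sound (⋃E? p _ y) m)
    where
    prev-parity : parity (toℕ (prev i)) ≡ p
    prev-parity = ℙ.⁻¹-injective (trans (sym (parity-next even (prev i)))
      (trans (cong (λ k → parity (toℕ k)) (next-prev i)) h))

    unique : ∀ {y} → ⋃E p (i , j) y → (prev i , j) ≡ y
    unique (k , h′ , _ , inj₁ (refl , refl)) =
      contradiction (trans (sym h′) h) (p≢p⁻¹ p)
    unique (k , _  , _ , inj₂ (refl , refl)) = cong (_, j) (prev-next k)

private
  parity-2* : ∀ m → parity (2 * m) ≡ 0ℙ
  parity-2* m = *-homo-* 2 m

-- Modulo 2m the indices 1, 3, …, 2m-1 are the odd elements of Fin (2 * m), and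
-- 2, 4, …, 2m are the even ones, the index 2m being 0.
M₁ : ∀ n m → PerfectMatching (T (2 * n + 1) (2 * m))
M₁ n m = alternating (2 * n + 1) (2 * m) (parity-2* m) 1ℙ

M₂ : ∀ n m → PerfectMatching (T (2 * n + 1) (2 * m))
M₂ n m = alternating (2 * n + 1) (2 * m) (parity-2* m) 0ℙ

{-# OPTIONS --safe #-}

-- Rotating the torus by one step in the even direction is an automorphism of
-- the embedded graph which exchanges M₁ and M₂. Pulling matchings back along
-- it is an automorphism of the whole total resonance graph, and hence maps the
-- component of M₁ isomorphically onto that of M₂.

module Submission where

open import Defs
open import Data.Bool.Base using (_xor_)
open import Data.Fin.Base using (Fin; toℕ)
open import Data.Nat.Base using (ℕ; _+_; _*_; _≥_; parity)
open import Data.Parity.Base using (Parity; 0ℙ; 1ℙ; _⁻¹)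
open import Data.Parity.Properties using (⁻¹-injective; *-homo-*)
open import Data.Product using (_×_; _,_; proj₁; proj₂; map₁)
open import Data.Sum.Base as Sum using (inj₁; inj₂)
open import Function.Bundles
  using (Inverse; _↔_; mk↔ₛ′; _⇔_; mk⇔; module Equivalence)
open import Function.Construct.Composition using (_⇔-∘_)
open import Function.Construct.Symmetry using (⇔-sym; ↔-sym)
open import Function.Definitions using (Injective)
open import Relation.Binary.Bundles using (Setoid)
open import Relation.Binary.Construct.Closure.ReflexiveTransitive
  using (Star; ε; _◅_)
open import Relation.Binary.PropositionalEquality
  using (_≡_; refl; sym; trans; cong; cong₂; subst; subst₂)
open import Relation.Nullary.Decidable using (does-⇔)

module _ {G : Graph} where
  private module G where
    open Graph G public
    open Setoid vertices public using (sym; trans)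

  -- A walk starts exactly at its source and has slack up to `≈` only at its end. An empty walk
  -- absorbs `u ≈ v` into that slack; otherwise `resp` moves the first edge.
  Reachable-resp-source : ∀ {u v w} → u G.≈ v → Reachable G u w → Reachable G v w
  Reachable-resp-source u≈v (_ , ε , u≈w) =
    _ , ε , G.trans (G.sym u≈v) u≈w
  Reachable-resp-source u≈v (_ , u~x ◅ walk , eq) =
    _ , proj₂ G.resp u≈v u~x ◅ walk , eq

module _ {G H : Graph} (φ : G ≅ H) where
  private
    module G where
      open Graph G public
      open Setoid vertices public using (refl)
    module H where
      open Graph H public
      open Setoid vertices public using (sym)
    open module φ = _≅_ φ using (to; from; adjacent)

  ≅-sym : H ≅ G
  ≅-sym = record
    { bijection = record
      { to        = from
      ; from      = to
      ; to-cong   = φ.from-cong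
      ; from-cong = φ.to-cong
      ; inverse   = φ.inverseʳ , φ.inverseˡ
      }
    ; adjacent = mk⇔
        (λ x~y → Equivalence.from adjacent
          (proj₁ H.resp (to-from _) (proj₂ H.resp (to-from _) x~y)))
        (λ fx~fy → proj₁ H.resp (H.sym (to-from _))
          (proj₂ H.resp (H.sym (to-from _)) (Equivalence.to adjacent fx~fy)))
    }
    where
    to-from : ∀ y → y H.≈ to (from y)
    to-from y = H.sym (φ.inverseˡ G.refl)

  Star-map : ∀ {u w} → Star G._~_ u w → Star H._~_ (to u) (to w)
  Star-map ε            = ε
  Star-map (u~x ◅ walk) = Equivalence.to adjacent u~x ◅ Star-map walk

  Reachable-map : ∀ {u v w} → to u H.≈ v → Reachable G u w → Reachable H v (to w)
  Reachable-map tou≈v (x , walk , x≈w) =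
    Reachable-resp-source {H} tou≈v (to x , Star-map walk , φ.to-cong x≈w)

-- `φ` and its inverse both carry walks to walks. Equality and adjacency in a component ignore the
-- walk, so the remaining laws are those of `φ`.
component-≅ : ∀ {G H} (φ : G ≅ H) {u v} → Graph._≈_ H (_≅_.to φ u) v →
              component G u ≅ component H v
component-≅ {G} {H} φ {u} {v} tou≈v = record
  { bijection = record
    { to        = λ (w , r) → φ.to w , Reachable-map φ tou≈v r
    ; from      = λ (w , r) → φ.from w ,
        Reachable-map (≅-sym φ) (φ.inverseʳ (Setoid.sym (Graph.vertices H) tou≈v)) r
    ; to-cong   = φ.to-cong
    ; from-cong = φ.from-cong
    ; inverse   = φ.inverseˡ , φ.inverseʳ
    }
  ; adjacent = φ.adjacent
  }
  where module φ = _≅_ φ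

-- The face map is separate data because `∂` may be the same for two faces, so the vertex map need
-- not determine it.
record Automorphism (G : EmbeddedGraph) : Set where
  open EmbeddedGraph G
  field
    vertex : Vertex ↔ Vertex
    face   : Face ↔ Face
  module vertex = Inverse vertex
  module face   = Inverse face
  field
    ~-⇔ : ∀ x y → x ~ y ⇔ vertex.to x ~ vertex.to y
    ∂-⇔ : ∀ f x y → ∂ f x y ⇔ ∂ (face.to f) (vertex.to x) (vertex.to y)

module _ {G : EmbeddedGraph} where
  open EmbeddedGraph G using (_~_; ∂)
  open PerfectMatching

  inverse : Automorphism G → Automorphism G
  inverse α = record
    { vertex = ↔-sym vertex
    ; face   = ↔-sym face
    ; ~-⇔    = λ x y → ⇔-sym (subst₂ (λ x′ y′ → _ ⇔ x′ ~ y′)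
        (vertex.strictlyInverseˡ x) (vertex.strictlyInverseˡ y)
        (~-⇔ (vertex.from x) (vertex.from y)))
    ; ∂-⇔    = λ f x y → ⇔-sym (subst₂ (λ x′ y′ → _ ⇔ ∂ f x′ y′)
        (vertex.strictlyInverseˡ x) (vertex.strictlyInverseˡ y)
        (subst (λ f′ → _ ⇔ ∂ f′ _ _) (face.strictlyInverseˡ f)
          (∂-⇔ (face.from f) (vertex.from x) (vertex.from y))))
    }
    where open Automorphism α

  module _ (α : Automorphism G) where
    open Automorphism α

    pullback : PerfectMatching G → PerfectMatching G
    pullback M = record
      { edge    = λ x y → edge M (vertex.to x) (vertex.to y)
      ; symm    = λ x y → symm M (vertex.to x) (vertex.to y)
      ; ⊆~      = λ x y e → Equivalence.from (~-⇔ x y) (⊆~ M _ _ e)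
      ; perfect = λ x → let y , e , unique = perfect M (vertex.to x) in
          -- The partner of `x` is the preimage of the partner that `M` gives to the image of `x`.
          vertex.from y
        , subst (λ y′ → edge M _ y′ ≡ _) (sym (vertex.strictlyInverseˡ y)) e
        , λ e′ → vertex.inverseʳ (unique e′)
      }

    -- The symmetric difference of the pullbacks is, by computation, the pullback of the symmetric
    -- difference. If the latter bounds `f`, the former bounds the face that `α` sends to `f`.
    pullback-adjacent : ∀ {M M′} → Graph._~_ (Rₜ G) M M′ →
                        Graph._~_ (Rₜ G) (pullback M) (pullback M′)
    pullback-adjacent (f , h) = face.from f , λ x y →
      ⇔-sym (subst (λ f′ → _ ⇔ ∂ f′ _ _) (face.strictlyInverseˡ f)
        (∂-⇔ (face.from f) x y))
      ⇔-∘ h (vertex.to x) (vertex.to y)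

  module _ (α : Automorphism G) where
    open Automorphism α
    private
      β = inverse α

      -- Pullback is contravariant, so each inverse law for matchings comes from the opposite one
      -- for vertices.
      pullback-inverseˡ : ∀ M x y → edge (pullback α (pullback β M)) x y ≡ edge M x y
      pullback-inverseˡ M x y =
        cong₂ (edge M) (vertex.strictlyInverseʳ x) (vertex.strictlyInverseʳ y)

      pullback-inverseʳ : ∀ M x y → edge (pullback β (pullback α M)) x y ≡ edge M x y
      pullback-inverseʳ M x y =
        cong₂ (edge M) (vertex.strictlyInverseˡ x) (vertex.strictlyInverseˡ y)

    pullback-≅ : Rₜ G ≅ Rₜ G
    pullback-≅ = record
      { bijection = record
        { to        = pullback α
        ; from      = pullback β
        ; to-cong   = λ M≈M′ x y → M≈M′ (vertex.to x) (vertex.to y)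
        ; from-cong = λ M≈M′ x y → M≈M′ (vertex.from x) (vertex.from y)
        ; inverse   =
            (λ {M} M′≈ x y → trans (M′≈ _ _) (pullback-inverseˡ M x y))
          , (λ {M} M′≈ x y → trans (M′≈ _ _) (pullback-inverseʳ M x y))
        }
      ; adjacent = λ {M} {M′} → mk⇔ (pullback-adjacent α {M} {M′}) (reflect {M} {M′})
      }
      where
      reflect : ∀ {M M′} → Graph._~_ (Rₜ G) (pullback α M) (pullback α M′) →
                Graph._~_ (Rₜ G) M M′
      reflect {M} {M′} αM~αM′ =
        -- Pulling back along `β` returns to `M` and `M′` only pointwise, which suffices to rewrite
        -- their symmetric difference.
        let f , h = pullback-adjacent β {pullback α M} {pullback α M′} αM~αM′ in
        f , λ x y → subst (λ b → b ≡ _ ⇔ ∂ f x y)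
          (cong₂ _xor_ (pullback-inverseʳ M x y) (pullback-inverseʳ M′ x y))
          (h x y)

module _ {V W : Set} {g : V → W} where

  Joins-⇔ : Injective _≡_ _≡_ g → ∀ {p q x y} →
            Joins p q x y ⇔ Joins (g p) (g q) (g x) (g y)
  Joins-⇔ inj = mk⇔
    (λ where (inj₁ (a , b)) → inj₁ (cong g a , cong g b)
             (inj₂ (a , b)) → inj₂ (cong g a , cong g b))
    (λ where (inj₁ (a , b)) → inj₁ (inj a , inj b)
             (inj₂ (a , b)) → inj₂ (inj a , inj b))

module _ {a b : ℕ} where
  open EmbeddedGraph (T a b)

  private
    rotate : Vertex → Vertex
    rotate = map₁ next

    joins : ∀ {p q x y} →
            Joins p q x y ⇔ Joins (rotate p) (rotate q) (rotate x) (rotate y)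
    joins = Joins-⇔ λ eq → cong₂ _,_ (next-injective (cong proj₁ eq)) (cong proj₂ eq)

    module joins {p q x y} = Equivalence (joins {p} {q} {x} {y})

  -- Faces are indexed by a corner, so the same map rotates vertices and faces; it sends the four
  -- sides of a face to those of the next one in the same order.
  rotation : Automorphism (T a b)
  rotation = record
    { vertex = rotate-↔
    ; face   = rotate-↔
    ; ~-⇔    = λ x y → mk⇔
        (λ (i , j , e) → next i , j , Sum.map joins.to joins.to e)
        (λ (i , j , e) → reflect i j e)
    ; ∂-⇔    = λ f x y → mk⇔
        (Sum.map joins.to (Sum.map joins.to (Sum.map joins.to joins.to)))
        (Sum.map joins.from (Sum.map joins.from (Sum.map joins.from joins.from)))
    }
    where
    rotate-↔ : (Fin b × Fin a) ↔ (Fin b × Fin a)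
    rotate-↔ = mk↔ₛ′ rotate (map₁ prev)
      (λ (i , j) → cong (_, j) (next-prev i)) (λ (i , j) → cong (_, j) (prev-next i))

    reflect : ∀ i j {x y} → _ → x ~ y
    -- Writing `i` as `next k` exhibits the edge as a rotated one, so that injectivity of the
    -- rotation applies.
    reflect i j {x} {y} e with prev i | next-prev i
    ... | k | refl = k , j , Sum.map joins.from joins.from e

  -- For even `b`, `next` flips parity also where it wraps from `b - 1` to 0, so rotation exchanges
  -- the two parity classes.
  rotation-⋃E : parity b ≡ 0ℙ → ∀ p x y →
                ⋃E {a} {b} (p ⁻¹) (rotate x) (rotate y) ⇔ ⋃E {a} {b} p x y
  rotation-⋃E even p x y = mk⇔
    (λ (i , h , j , e) → reflect i h j e)
    (λ (i , h , j , e) →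
      next i , trans (parity-next even i) (cong _⁻¹ h) , j , joins.to e)
    where
    reflect : ∀ i → parity (toℕ i) ≡ p ⁻¹ → ∀ j →
              Joins (i , j) (next i , j) (rotate x) (rotate y) → ⋃E p x y
    reflect i h j e with prev i | next-prev i
    ... | k | refl =
      k , ⁻¹-injective (trans (sym (parity-next even k)) h) , j , joins.from e

theorem4p4 : (n m : ℕ) → n ≥ 1 → m ≥ 2 →
    component (Rₜ (T (2 * n + 1) (2 * m))) (M₁ n m)
    ≅ component (Rₜ (T (2 * n + 1) (2 * m))) (M₂ n m)
theorem4p4 n m _ _ = component-≅ (pullback-≅ rotation) λ x y →
  -- The pullback of `M₁ n m` is `M₂ n m`: at parity `0ℙ` the rotated class `0ℙ ⁻¹` computes to
  -- `1ℙ`.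
  does-⇔ (rotation-⋃E (*-homo-* 2 m) 0ℙ x y) (⋃E? 1ℙ _ _) (⋃E? 0ℙ x y)
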